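{- Let $d \geq 1$ and let $\Gamma \subset \mathbb{Z}^d \setminus \{\mathbf{0}\}$ be a rule set on $\mathbb{N}^d$. The following conditions are equivalent. (1) For each $\gamma \in \Gamma$ and all $p, q \in \mathbb{N}^d$, if $p + q - \gamma \in \mathbb{N}^d$ then $p - \gamma \in \mathbb{N}^d$ or $q - \gamma \in \mathbb{N}^d$. (3) Each $\gamma \in \Gamma$ has at most one positive entry, and that entry is at most $1$. (4) For every $\gamma \in \Gamma$, the positive part $\gamma_+$ is a 0-1 vector with at most one entry equal to $1$. (5) In the language of heaps, each move decreases the number of heaps of exactly one size, and the amount of the decrease is $1$; that is, for each $\gamma \in \Gamma$ there is exactly one index $i$ with $\gamma_i > 0$, and for this index $\gamma_i = 1$.
   Context: $\mathbb{N} = \{0,1,2,\ldots\}$. A finite subset $\Gamma \subset \mathbb{Z}^d \setminus \{\mathbf{0}\}$ is a rule set on $\mathbb{N}^d$ if: (a) there is a linear function $\ell : \mathbb{R}^d \to \mathbb{R}$ that is positive on every element of $\Gamma$ and on every nonzero vector of $\mathbb{R}_{\geq 0}^d$; and (b) (tangent cone axiom) for each $i \in \{1,\ldots,d\}$ there is some $\gamma \in \Gamma$ with $\gamma_j \leq 0$ for all $j \neq i$. A move $\gamma \in \Gamma$ takes a position $p \in \mathbb{N}^d$ to $p - \gamma$, and is legal when $p - \gamma \in \mathbb{N}^d$. In heap language, a position $p = (p_1,\ldots,p_d) \in \mathbb{N}^d$ represents a collection of heaps in which exactly $p_i$ heaps have size $i$, so the move $\gamma$ decreases the number of heaps of size $i$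 by $\gamma_i$ if $\gamma_i > 0$, and does not decrease it otherwise. The positive part of $\gamma$ is $\gamma_+ = (\max\{\gamma_1,0\},\ldots,\max\{\gamma_d,0\})$. -}

module Defs where

open import Algebra.Bundles using (RawRing)
open import Algebra.Module.Bundles using (RawLeftModule)
open import Algebra.Module.Construct.TensorUnit using (rawLeftModule)
open import Algebra.Module.Morphism.Structures using (module LeftModuleMorphisms)
open import Data.Fin using (Fin)
open import Data.Integer as ℤ using (ℤ; 0ℤ; 1ℤ)
open import Data.List using (List)
open import Data.List.Membership.Propositional using (_∈_)
open import Data.Nat as ℕ using (ℕ)
import Data.Nat.Properties as ℕ
open import Data.Product using (Σ; ∃; ∃!; _×_; _,_)
open import Data.Rational as ℚ using (ℚ; 0ℚ; 1ℚ; ½)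
import Data.Rational.Properties as ℚ
open import Data.Rational.Solver using (module +-*-Solver)
open import Data.Sum using (_⊎_)
open import Data.Vec using (Vec; lookup; map; replicate; zipWith)
open import Data.Vec.Functional using (Vector)
open import Level using (0ℓ)
open import Relation.Binary.PropositionalEquality using (_≡_; _≢_; refl; sym; trans; cong; subst)
open import Relation.Nullary using (¬_)

IsCauchy : (ℕ → ℚ) → Set
IsCauchy u = ∀ ε → 0ℚ ℚ.< ε →
  ∃ λ N → ∀ m n → N ℕ.≤ m → N ℕ.≤ n → ℚ.∣ u m ℚ.- u n ∣ ℚ.< ε

-- Distinct sequences may represent the same real number: equality is _≈ℝ_ below.
record ℝ : Set where
  constructor mkℝ
  field
    seq    : ℕ → ℚ
    cauchy : IsCauchy seq

open ℝ public

private
  halve-pos : ∀ {ε} → 0ℚ ℚ.< ε → 0ℚ ℚ.< ½ ℚ.* ε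
  halve-pos {ε} ε>0 = subst (ℚ._< ½ ℚ.* ε) (ℚ.*-zeroʳ ½) (ℚ.*-monoʳ-<-pos ½ ε>0)

  halves : ∀ ε → ½ ℚ.* ε ℚ.+ ½ ℚ.* ε ≡ ε
  halves ε = trans (sym (ℚ.*-distribʳ-+ ε ½ ½)) (ℚ.*-identityˡ ε)

  const-cauchy : ∀ p → IsCauchy (λ _ → p)
  const-cauchy p ε ε>0 =
    0 , λ _ _ _ _ → subst (λ t → ℚ.∣ t ∣ ℚ.< ε) (sym (ℚ.+-inverseʳ p)) ε>0

  neg-cauchy : ∀ u → IsCauchy u → IsCauchy (λ n → ℚ.- u n)
  neg-cauchy u cu ε ε>0 with cu ε ε>0
  ... | N , close = N , λ m n N≤m N≤n →
    subst (ℚ._< ε)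
      (trans (sym (ℚ.∣-p∣≡∣p∣ _)) (cong ℚ.∣_∣ (ℚ.neg-distrib-+ (u m) (ℚ.- u n))))
      (close m n N≤m N≤n)

  +-cauchy : ∀ u v → IsCauchy u → IsCauchy v → IsCauchy (λ n → u n ℚ.+ v n)
  +-cauchy u v cu cv ε ε>0
    with cu (½ ℚ.* ε) (halve-pos ε>0) | cv (½ ℚ.* ε) (halve-pos ε>0)
  ... | M , closeᵤ | N , closeᵥ = M ℕ.⊔ N , λ m n ≤m ≤n → begin-strict
      ℚ.∣ (u m ℚ.+ v m) ℚ.- (u n ℚ.+ v n) ∣
        ≡⟨ cong ℚ.∣_∣ (rearrange (u m) (v m) (u n) (v n)) ⟩
      ℚ.∣ (u m ℚ.- u n) ℚ.+ (v m ℚ.- v n) ∣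
        ≤⟨ ℚ.∣p+q∣≤∣p∣+∣q∣ (u m ℚ.- u n) (v m ℚ.- v n) ⟩
      ℚ.∣ u m ℚ.- u n ∣ ℚ.+ ℚ.∣ v m ℚ.- v n ∣
        <⟨ ℚ.+-mono-< (closeᵤ m n (ℕ.m⊔n≤o⇒m≤o M N ≤m) (ℕ.m⊔n≤o⇒m≤o M N ≤n))
                      (closeᵥ m n (ℕ.m⊔n≤o⇒n≤o M N ≤m) (ℕ.m⊔n≤o⇒n≤o M N ≤n)) ⟩
      ½ ℚ.* ε ℚ.+ ½ ℚ.* ε
        ≡⟨ halves ε ⟩
      ε ∎
    where
    open ℚ.≤-Reasoning
    open +-*-Solver
    rearrange : ∀ a b c d →
      (a ℚ.+ b) ℚ.- (c ℚ.+ d) ≡ (a ℚ.- c) ℚ.+ (b ℚ.- d)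
    rearrange = solve 4 (λ a b c d → (a :+ b) :- (c :+ d) := (a :- c) :+ (b :- d)) refl

  Bound : (ℕ → ℚ) → Set
  Bound u = ∃ λ B → 0ℚ ℚ.< B × ∃ λ N → ∀ n → N ℕ.≤ n → ℚ.∣ u n ∣ ℚ.≤ B

  bounded : ∀ u → IsCauchy u → Bound u
  bounded u cu with cu 1ℚ (ℚ.positive⁻¹ 1ℚ)
  ... | N , close =
      1ℚ ℚ.+ ℚ.∣ u N ∣
    , ℚ.+-mono-<-≤ (ℚ.positive⁻¹ 1ℚ) (ℚ.0≤∣p∣ (u N))
    , N
    , λ n N≤n → begin
        ℚ.∣ u n ∣
          ≡⟨ cong ℚ.∣_∣ (split (u n) (u N)) ⟩
        ℚ.∣ (u n ℚ.- u N) ℚ.+ u N ∣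
          ≤⟨ ℚ.∣p+q∣≤∣p∣+∣q∣ (u n ℚ.- u N) (u N) ⟩
        ℚ.∣ u n ℚ.- u N ∣ ℚ.+ ℚ.∣ u N ∣
          ≤⟨ ℚ.+-monoˡ-≤ ℚ.∣ u N ∣ (ℚ.<⇒≤ (close n N N≤n ℕ.≤-refl)) ⟩
        1ℚ ℚ.+ ℚ.∣ u N ∣ ∎
    where
    open ℚ.≤-Reasoning
    open +-*-Solver
    split : ∀ a b → a ≡ (a ℚ.- b) ℚ.+ b
    split = solve 2 (λ a b → a := (a :- b) :+ b) refl

  scale : ∀ {B ε} → 0ℚ ℚ.< B → 0ℚ ℚ.< ε → ∃ λ δ → 0ℚ ℚ.< δ ×
    (∀ a b → ℚ.∣ a ∣ ℚ.≤ B → ℚ.∣ b ∣ ℚ.< δ → ℚ.∣ a ℚ.* b ∣ ℚ.< ε)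
  scale {B} {ε} B>0 ε>0 = δ , δ>0 , small
    where
    open ℚ.≤-Reasoning
    instance
      B-pos : ℚ.Positive B
      B-pos = ℚ.positive B>0
      B-nonZero : ℚ.NonZero B
      B-nonZero = ℚ.pos⇒nonZero B
    δ : ℚ
    δ = ℚ.1/ B ℚ.* ε
    δ>0 : 0ℚ ℚ.< δ
    δ>0 = subst (ℚ._< δ) (ℚ.*-zeroʳ (ℚ.1/ B))
      (ℚ.*-monoʳ-<-pos (ℚ.1/ B) {{ℚ.1/pos⇒pos B}} ε>0)
    small : ∀ a b → ℚ.∣ a ∣ ℚ.≤ B → ℚ.∣ b ∣ ℚ.< δ → ℚ.∣ a ℚ.* b ∣ ℚ.< ε
    small a b a≤B b<δ = begin-strict
      ℚ.∣ a ℚ.* b ∣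
        ≡⟨ ℚ.∣p*q∣≡∣p∣*∣q∣ a b ⟩
      ℚ.∣ a ∣ ℚ.* ℚ.∣ b ∣
        ≤⟨ ℚ.*-monoʳ-≤-nonNeg ℚ.∣ b ∣ {{ℚ.∣-∣-nonNeg b}} a≤B ⟩
      B ℚ.* ℚ.∣ b ∣
        <⟨ ℚ.*-monoʳ-<-pos B b<δ ⟩
      B ℚ.* (ℚ.1/ B ℚ.* ε)
        ≡⟨ sym (ℚ.*-assoc B (ℚ.1/ B) ε) ⟩
      (B ℚ.* ℚ.1/ B) ℚ.* ε
        ≡⟨ cong (ℚ._* ε) (ℚ.*-inverseʳ B) ⟩
      1ℚ ℚ.* ε
        ≡⟨ ℚ.*-identityˡ ε ⟩
      ε ∎

  *-cauchy : ∀ u v → IsCauchy u → IsCauchy v → IsCauchy (λ n → u n ℚ.* v n)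
  *-cauchy u v cu cv ε ε>0 = combine (bounded u cu) (bounded v cv)
    where
    open ℚ.≤-Reasoning
    open +-*-Solver
    rearrange : ∀ a b c d →
      a ℚ.* b ℚ.- c ℚ.* d ≡ a ℚ.* (b ℚ.- d) ℚ.+ d ℚ.* (a ℚ.- c)
    rearrange = solve 4
      (λ a b c d → a :* b :- c :* d := a :* (b :- d) :+ d :* (a :- c)) refl

    small : ∀ a b c d →
      ℚ.∣ a ℚ.* (b ℚ.- d) ∣ ℚ.< ½ ℚ.* ε → ℚ.∣ d ℚ.* (a ℚ.- c) ∣ ℚ.< ½ ℚ.* ε →
      ℚ.∣ a ℚ.* b ℚ.- c ℚ.* d ∣ ℚ.< ε
    small a b c d p q = begin-strict
      ℚ.∣ a ℚ.* b ℚ.- c ℚ.* d ∣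
        ≡⟨ cong ℚ.∣_∣ (rearrange a b c d) ⟩
      ℚ.∣ a ℚ.* (b ℚ.- d) ℚ.+ d ℚ.* (a ℚ.- c) ∣
        ≤⟨ ℚ.∣p+q∣≤∣p∣+∣q∣ (a ℚ.* (b ℚ.- d)) (d ℚ.* (a ℚ.- c)) ⟩
      ℚ.∣ a ℚ.* (b ℚ.- d) ∣ ℚ.+ ℚ.∣ d ℚ.* (a ℚ.- c) ∣
        <⟨ ℚ.+-mono-< p q ⟩
      ½ ℚ.* ε ℚ.+ ½ ℚ.* ε
        ≡⟨ halves ε ⟩
      ε ∎

    Controlled : (ℕ → ℚ) → (ℕ → ℚ) → Set
    Controlled w z = ∃ λ N → ∀ k m n → N ℕ.≤ k → N ℕ.≤ m → N ℕ.≤ n →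
      ℚ.∣ w k ℚ.* (z m ℚ.- z n) ∣ ℚ.< ½ ℚ.* ε

    control : ∀ w z → Bound w → IsCauchy z → Controlled w z
    control w z (B , B>0 , K , w≤B) cz =
      let δ , δ>0 , mul-small = scale B>0 (halve-pos ε>0)
          M , close = cz δ δ>0
      in K ℕ.⊔ M , λ k m n ≤k ≤m ≤n →
           mul-small (w k) (z m ℚ.- z n) (w≤B k (ℕ.m⊔n≤o⇒m≤o K M ≤k))
             (close m n (ℕ.m⊔n≤o⇒n≤o K M ≤m) (ℕ.m⊔n≤o⇒n≤o K M ≤n))

    combine : Bound u → Bound v → ∃ λ N → ∀ m n → N ℕ.≤ m → N ℕ.≤ n →
      ℚ.∣ u m ℚ.* v m ℚ.- u n ℚ.* v n ∣ ℚ.< ε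
    combine bu bv =
      let M , closeᵥ = control u v bu cv
          N , closeᵤ = control v u bv cu
      in M ℕ.⊔ N , λ m n ≤m ≤n → small (u m) (v m) (u n) (v n)
           (closeᵥ m m n (ℕ.m⊔n≤o⇒m≤o M N ≤m) (ℕ.m⊔n≤o⇒m≤o M N ≤m) (ℕ.m⊔n≤o⇒m≤o M N ≤n))
           (closeᵤ n m n (ℕ.m⊔n≤o⇒n≤o M N ≤n) (ℕ.m⊔n≤o⇒n≤o M N ≤m) (ℕ.m⊔n≤o⇒n≤o M N ≤n))

infix  4 _≈ℝ_ _<ℝ_ _≤ℝ_ _#ℝ_
infixl 6 _+ℝ_
infixl 7 _*ℝ_
infix  8 -ℝ_

fromℚ : ℚ → ℝ
fromℚ p = mkℝ (λ _ → p) (const-cauchy p)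

fromℤ : ℤ → ℝ
fromℤ z = fromℚ (z ℚ./ 1)

0ℝ 1ℝ : ℝ
0ℝ = fromℚ 0ℚ
1ℝ = fromℚ 1ℚ

_+ℝ_ _*ℝ_ : ℝ → ℝ → ℝ
x +ℝ y = mkℝ (λ n → seq x n ℚ.+ seq y n) (+-cauchy (seq x) (seq y) (cauchy x) (cauchy y))
x *ℝ y = mkℝ (λ n → seq x n ℚ.* seq y n) (*-cauchy (seq x) (seq y) (cauchy x) (cauchy y))

-ℝ_ : ℝ → ℝ
-ℝ x = mkℝ (λ n → ℚ.- seq x n) (neg-cauchy (seq x) (cauchy x))

_≈ℝ_ _<ℝ_ _≤ℝ_ _#ℝ_ : ℝ → ℝ → Set
x ≈ℝ y = ∀ ε → 0ℚ ℚ.< ε →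
  ∃ λ N → ∀ n → N ℕ.≤ n → ℚ.∣ seq x n ℚ.- seq y n ∣ ℚ.< ε
x <ℝ y = ∃ λ ε → 0ℚ ℚ.< ε × ∃ λ N → ∀ n → N ℕ.≤ n → seq x n ℚ.+ ε ℚ.≤ seq y n
x ≤ℝ y = ¬ (y <ℝ x)
x #ℝ y = x <ℝ y ⊎ y <ℝ x

ℝ-rawRing : RawRing 0ℓ 0ℓ
ℝ-rawRing = record
  { Carrier = ℝ ; _≈_ = _≈ℝ_ ; _+_ = _+ℝ_ ; _*_ = _*ℝ_ ; -_ = -ℝ_ ; 0# = 0ℝ ; 1# = 1ℝ }

ℝ^-rawLeftModule : ℕ → RawLeftModule ℝ 0ℓ 0ℓ
ℝ^-rawLeftModule d = record
  { Carrierᴹ = Vector ℝ d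
  ; _≈ᴹ_     = λ x y → ∀ i → x i ≈ℝ y i
  ; _+ᴹ_     = λ x y i → x i +ℝ y i
  ; _*ₗ_     = λ c x i → c *ℝ x i
  ; 0ᴹ       = λ _ → 0ℝ
  ; -ᴹ_      = λ x i → -ℝ x i
  }

-- The library's homomorphisms also record preservation of 0, of negation and of
-- equality; the first two follow from additivity, and the last says that the
-- function is well defined on real numbers rather than on Cauchy sequences.
IsLinear : ∀ {d} → (Vector ℝ d → ℝ) → Set
IsLinear {d} = IsLeftModuleHomomorphism
  where open LeftModuleMorphisms (ℝ^-rawLeftModule d) (rawLeftModule {R = ℝ-rawRing})

NonNegative : ∀ {d} → Vector ℝ d → Set
NonNegative x = ∀ i → 0ℝ ≤ℝ x i

-- Apartness from the zero vector, classically the same as x ≉ 0. With x ≉ 0 the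
-- positivity axiom below would require Markov's principle even for ℓ x = x 0.
Nonzero : ∀ {d} → Vector ℝ d → Set
Nonzero x = ∃ λ i → x i #ℝ 0ℝ

toℝ^ : ∀ {d} → Vec ℤ d → Vector ℝ d
toℝ^ γ i = fromℤ (lookup γ i)

-- The list Γ enumerates a finite set: only membership is used, so neither order
-- nor repetitions matter.
record IsRuleSet {d} (Γ : List (Vec ℤ d)) : Set where
  field
    nonzero      : ∀ γ → γ ∈ Γ → γ ≢ replicate d 0ℤ
    positivity   : ∃ λ (ℓ : Vector ℝ d → ℝ) → IsLinear ℓ
                   × (∀ γ → γ ∈ Γ → 0ℝ <ℝ ℓ (toℝ^ γ))
                   × (∀ x → NonNegative x → Nonzero x → 0ℝ <ℝ ℓ x)
    tangent-cone : ∀ i → ∃ λ γ → γ ∈ Γ × (∀ j → j ≢ i → lookup γ j ℤ.≤ 0ℤ)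

infix  4 _∈ℕ^
infixl 6 _+ᵖ_ _-ᵖ_

_+ᵖ_ : ∀ {d} → Vec ℕ d → Vec ℕ d → Vec ℕ d
_+ᵖ_ = zipWith ℕ._+_

_-ᵖ_ : ∀ {d} → Vec ℕ d → Vec ℤ d → Vec ℤ d
p -ᵖ γ = zipWith ℤ._-_ (map ℤ.+_ p) γ

_∈ℕ^ : ∀ {d} → Vec ℤ d → Set
v ∈ℕ^ = ∃ λ p → map ℤ.+_ p ≡ v

_₊ : ∀ {d} → Vec ℤ d → Vec ℤ d
γ ₊ = map (ℤ._⊔ 0ℤ) γ

SplitsLegalMoves : ∀ {d} → List (Vec ℤ d) → Set
SplitsLegalMoves Γ = ∀ γ → γ ∈ Γ → ∀ p q →
  (p +ᵖ q) -ᵖ γ ∈ℕ^ → p -ᵖ γ ∈ℕ^ ⊎ q -ᵖ γ ∈ℕ^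

AtMostOnePositiveEntryAtMost1 : ∀ {d} → List (Vec ℤ d) → Set
AtMostOnePositiveEntryAtMost1 Γ = ∀ γ → γ ∈ Γ →
    (∀ i j → 0ℤ ℤ.< lookup γ i → 0ℤ ℤ.< lookup γ j → i ≡ j)
  × (∀ i → 0ℤ ℤ.< lookup γ i → lookup γ i ℤ.≤ 1ℤ)

PositivePart01AtMostOne1 : ∀ {d} → List (Vec ℤ d) → Set
PositivePart01AtMostOne1 Γ = ∀ γ → γ ∈ Γ →
    (∀ i → lookup (γ ₊) i ≡ 0ℤ ⊎ lookup (γ ₊) i ≡ 1ℤ)
  × (∀ i j → lookup (γ ₊) i ≡ 1ℤ → lookup (γ ₊) j ≡ 1ℤ → i ≡ j)

DecreasesExactlyOneSizeBy1 : ∀ {d} → List (Vec ℤ d) → Set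
DecreasesExactlyOneSizeBy1 {d} Γ = ∀ γ → γ ∈ Γ →
  Σ (∃! _≡_ λ (i : Fin d) → 0ℤ ℤ.< lookup γ i) λ (i , _) → lookup γ i ≡ 1ℤ

{-# OPTIONS --safe #-}

-- A rule γ without a positive entry would make −γ a nonzero vector of the orthant,
-- so that ℓ γ and ℓ (−γ) = −ℓ γ would both be positive; hence every rule has a
-- positive entry, which is what (5) adds to (3).
-- For (1) ⇒ (3), let γᵢ > 0 and split a legal position as eᵢ + q with qᵢ = γᵢ − 1.
-- The move is illegal at q, hence legal at eᵢ, and γ ≤ eᵢ is what (3) says.
module Submission where

open import Defs
open import Algebra.Module.Construct.TensorUnit using (rawLeftModule)
open import Algebra.Module.Morphism.Structures using (module LeftModuleMorphisms)
open import Algebra.Properties.Group using (⁻¹-involutive)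
open import Data.Fin using (Fin)
open import Data.Fin.Properties using (any?; _≟_)
open import Data.Integer as ℤ using (ℤ; +_; -[1+_]; 0ℤ; 1ℤ; ∣_∣; +≤+; -≤+; +<+)
import Data.Integer.Properties as ℤ
open import Data.List using (List)
open import Data.List.Membership.Propositional using (_∈_)
open import Data.Nat as ℕ using (ℕ; zero; suc; pred; z≤n; s≤s; _≥_)
import Data.Nat.Properties as ℕ
open import Data.Product using (∃; _×_; _,_; proj₁; proj₂)
open import Data.Rational as ℚ using (ℚ; 0ℚ)
import Data.Rational.Properties as ℚ
open import Data.Sum using (_⊎_; inj₁; inj₂)
open import Data.Vec using (Vec; lookup; map; replicate; updateAt; _[_]≔_)
open import Data.Vec.Functional using (Vector)
open import Data.Vec.Properties
  using (lookup-map; lookup-zipWith; lookup-replicate;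
         lookup∘updateAt; lookup∘updateAt′; lookup∘update; lookup∘update′)
open import Data.Vec.Relation.Binary.Pointwise.Extensional using (ext; Pointwise-≡⇒≡)
open import Function.Base using (_∘_)
open import Function.Bundles using (_⇔_; mk⇔; module Equivalence)
open import Function.Construct.Composition using (_⇔-∘_)
open import Function.Construct.Symmetry using (⇔-sym)
open import Relation.Binary.PropositionalEquality
  using (_≡_; _≢_; refl; sym; trans; cong; subst)
open import Relation.Nullary using (¬_; yes; no; contradiction)

private
  variable
    d : ℕ

-- Equality of vectors and integer inequalities.

lookup-injective : ∀ {A : Set} {xs ys : Vec A d} → (∀ i → lookup xs i ≡ lookup ys i) → xs ≡ ys
lookup-injective = Pointwise-≡⇒≡ ∘ ext

0<i≤1⇒i≡1 : ∀ {i} → 0ℤ ℤ.< i → i ℤ.≤ 1ℤ → i ≡ 1ℤ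
0<i≤1⇒i≡1 0<i i≤1 = ℤ.≤-antisym i≤1 (ℤ.i<j⇒suc[i]≤j 0<i)

i≤+∣i∣ : ∀ i → i ℤ.≤ + ∣ i ∣
i≤+∣i∣ (+ n)    = ℤ.≤-refl
i≤+∣i∣ -[1+ n ] = -≤+

-- Rules out legality at the vector `q` of `splits⇒≤unit`, which falls one short at a positive
-- coordinate. Positivity matters: at 0 the truncated `pred` would leave the bound true.
0<i⇒i≰pred∣i∣ : ∀ {i} → 0ℤ ℤ.< i → ¬ (i ℤ.≤ + pred ∣ i ∣)
0<i⇒i≰pred∣i∣ {+ suc n} _        (+≤+ n<n) = ℕ.<-irrefl refl n<n
0<i⇒i≰pred∣i∣ {+ zero}  (+<+ ())

-- Signs of integers inside the rationals and reals.

0<-fromℤ : ∀ n → 0ℚ ℚ.< ℚ.- (-[1+ n ] ℚ./ 1)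
-- A negative numerator makes `ℚ._/_` unfold to a negated `normalize`, so the goal is a double
-- negation.
0<-fromℤ n = subst (0ℚ ℚ.<_) (sym (⁻¹-involutive ℚ.+-0-group (ℚ.normalize (suc n) 1)))
  (ℚ.positive⁻¹ _ {{ℚ.normalize-pos (suc n) 1}})

0≤-fromℤ : ∀ {z} → z ℤ.≤ 0ℤ → 0ℚ ℚ.≤ ℚ.- (z ℚ./ 1)
0≤-fromℤ {+ zero}   _        = ℚ.≤-refl
0≤-fromℤ {+ suc n}  (+≤+ ())
0≤-fromℤ { -[1+ n ]} _       = ℚ.<⇒≤ (0<-fromℤ n)

fromℚ-mono-≤ : ∀ {p q} → p ℚ.≤ q → fromℚ p ≤ℝ fromℚ q
fromℚ-mono-≤ {p} {q} p≤q (ε , ε>0 , N , q+ε≤p) = ℚ.<-irrefl refl (begin-strict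
  p          ≡⟨ ℚ.+-identityʳ p ⟨
  p ℚ.+ 0ℚ   <⟨ ℚ.+-mono-≤-< p≤q ε>0 ⟩
  q ℚ.+ ε    ≤⟨ q+ε≤p N ℕ.≤-refl ⟩
  p          ∎)
  where open ℚ.≤-Reasoning

fromℚ-pos : ∀ {p} → 0ℚ ℚ.< p → 0ℝ <ℝ fromℚ p
fromℚ-pos {p} 0<p = p , 0<p , 0 , λ _ _ → ℚ.≤-reflexive (ℚ.+-identityˡ p)

-fromℤ-pos : ∀ {z} → z ℤ.< 0ℤ → 0ℝ <ℝ -ℝ fromℤ z
-- The order on reals inspects sequences only, so a fact about `fromℚ` of the negated rational
-- applies although the Cauchy proofs differ.
-fromℤ-pos { -[1+ n ]} _        = fromℚ-pos (0<-fromℤ n)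
-fromℤ-pos {+ _}       (+<+ ())

-- The distance from x to -y is x + y, which eventually stays at least ε, the witness of 0 < x.
-- Equality at tolerance ε would push it below ε.
pos-pos⇒≉neg : ∀ x y → 0ℝ <ℝ x → 0ℝ <ℝ y → ¬ (x ≈ℝ -ℝ y)
pos-pos⇒≉neg x y (ε , ε>0 , K , ε≤x) (δ , δ>0 , M , δ≤y) x≈-y = ℚ.<-irrefl refl (begin-strict
  ε                  ≡⟨ ℚ.+-identityˡ ε ⟨
  0ℚ ℚ.+ ε           ≤⟨ ε≤x n K≤n ⟩
  a                  ≡⟨ ℚ.+-identityʳ a ⟨
  a ℚ.+ 0ℚ           ≤⟨ ℚ.+-monoʳ-≤ a 0≤b ⟩
  a ℚ.+ b            ≡⟨ cong (a ℚ.+_) (⁻¹-involutive ℚ.+-0-group b) ⟨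
  a ℚ.- (ℚ.- b)      ≡⟨ ℚ.0≤p⇒∣p∣≡p 0≤a+b ⟨
  ℚ.∣ a ℚ.- ℚ.- b ∣  <⟨ close n N≤n ⟩
  ε                  ∎)
  where
  open ℚ.≤-Reasoning
  N : ℕ
  N = proj₁ (x≈-y ε ε>0)
  close : ∀ n → N ℕ.≤ n → ℚ.∣ seq x n ℚ.- ℚ.- seq y n ∣ ℚ.< ε
  close = proj₂ (x≈-y ε ε>0)
  n : ℕ
  n = (K ℕ.⊔ M) ℕ.⊔ N
  K≤n : K ℕ.≤ n
  K≤n = ℕ.≤-trans (ℕ.m≤m⊔n K M) (ℕ.m≤m⊔n _ N)
  M≤n : M ℕ.≤ n
  M≤n = ℕ.≤-trans (ℕ.m≤n⊔m K M) (ℕ.m≤m⊔n _ N)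
  N≤n : N ℕ.≤ n
  N≤n = ℕ.m≤n⊔m (K ℕ.⊔ M) N
  a b : ℚ
  a = seq x n
  b = seq y n
  0≤a : 0ℚ ℚ.≤ a
  0≤a = ℚ.≤-trans (ℚ.+-mono-≤ ℚ.≤-refl (ℚ.<⇒≤ ε>0)) (ε≤x n K≤n)
  0≤b : 0ℚ ℚ.≤ b
  0≤b = ℚ.≤-trans (ℚ.+-mono-≤ ℚ.≤-refl (ℚ.<⇒≤ δ>0)) (δ≤y n M≤n)
  0≤a+b : 0ℚ ℚ.≤ a ℚ.- (ℚ.- b)
  0≤a+b = subst (λ t → 0ℚ ℚ.≤ a ℚ.+ t) (sym (⁻¹-involutive ℚ.+-0-group b)) (ℚ.+-mono-≤ 0≤a 0≤b)

-- Existence of a positive entry.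

negative-entry : (γ : Vec ℤ d) → γ ≢ replicate d 0ℤ → (∀ i → lookup γ i ℤ.≤ 0ℤ) →
  ∃ λ i → lookup γ i ℤ.< 0ℤ
-- Deciding finitely many comparisons produces an actual index, which `Nonzero` demands.
negative-entry {d} γ γ≢0 γ≤0 with any? (λ i → lookup γ i ℤ.<? 0ℤ)
... | yes neg = neg
... | no ¬neg = contradiction
  (lookup-injective λ i →
    trans (ℤ.≤-antisym (γ≤0 i) (ℤ.≮⇒≥ (λ γᵢ<0 → ¬neg (i , γᵢ<0)))) (sym (lookup-replicate i 0ℤ)))
  γ≢0

positive-entry : {Γ : List (Vec ℤ d)} → IsRuleSet Γ → ∀ γ → γ ∈ Γ → ∃ λ i → 0ℤ ℤ.< lookup γ i
positive-entry ruleSet γ γ∈Γ with any? (λ i → 0ℤ ℤ.<? lookup γ i)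
... | yes pos = pos
... | no ¬pos =
  let ℓ , linear , ℓ-rule , ℓ-orthant = positivity
      k , γₖ<0 = negative-entry γ (nonzero γ γ∈Γ) γ≤0
      0<ℓ-γ = ℓ-orthant -γ (λ i → fromℚ-mono-≤ (0≤-fromℤ (γ≤0 i)))
                (k , inj₂ (-fromℤ-pos γₖ<0))
      open IsLeftModuleHomomorphism linear
  in contradiction (-ᴹ-homo (toℝ^ γ)) (pos-pos⇒≉neg (ℓ -γ) (ℓ (toℝ^ γ)) 0<ℓ-γ (ℓ-rule γ γ∈Γ))
  where
  open IsRuleSet ruleSet
  open LeftModuleMorphisms (ℝ^-rawLeftModule _) (rawLeftModule {R = ℝ-rawRing})
  -- Negating in the real module rather than in the integers lets `-ᴹ-homo` apply as it stands.
  -γ : Vector ℝ _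
  -γ i = -ℝ toℝ^ γ i
  γ≤0 : ∀ i → lookup γ i ℤ.≤ 0ℤ
  γ≤0 i = ℤ.≮⇒≥ (λ 0<γᵢ → ¬pos (i , 0<γᵢ))

-- Legality as a coordinatewise inequality.

∈ℕ^⇔nonneg : (v : Vec ℤ d) → v ∈ℕ^ ⇔ (∀ i → 0ℤ ℤ.≤ lookup v i)
∈ℕ^⇔nonneg v = mk⇔
  (λ { (p , refl) i → subst (0ℤ ℤ.≤_) (sym (lookup-map i +_ p)) (+≤+ z≤n) })
  (λ 0≤v → map ∣_∣ v , lookup-injective λ i →
    trans (lookup-map i +_ (map ∣_∣ v))
      (trans (cong +_ (lookup-map i ∣_∣ v)) (ℤ.0≤i⇒+∣i∣≡i (0≤v i))))

lookup-move : ∀ (p : Vec ℕ d) γ i → lookup (p -ᵖ γ) i ≡ + lookup p i ℤ.- lookup γ i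
lookup-move p γ i =
  trans (lookup-zipWith ℤ._-_ i (map +_ p) γ) (cong (ℤ._- lookup γ i) (lookup-map i +_ p))

legal⇒≤ : ∀ (p : Vec ℕ d) γ → p -ᵖ γ ∈ℕ^ → ∀ i → lookup γ i ℤ.≤ + lookup p i
legal⇒≤ p γ legal i = ℤ.0≤i-j⇒j≤i
  (subst (0ℤ ℤ.≤_) (lookup-move p γ i) (to (∈ℕ^⇔nonneg (p -ᵖ γ)) legal i))
  where open Equivalence

≤⇒legal : ∀ (p : Vec ℕ d) γ → (∀ i → lookup γ i ℤ.≤ + lookup p i) → p -ᵖ γ ∈ℕ^
≤⇒legal p γ γ≤p = from (∈ℕ^⇔nonneg (p -ᵖ γ))
  (λ i → subst (0ℤ ℤ.≤_) (sym (lookup-move p γ i)) (ℤ.i≤j⇒0≤j-i (γ≤p i)))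
  where open Equivalence

-- Splitting of legal moves against the bound on positive entries.

Splits : Vec ℤ d → Set
Splits γ = ∀ p q → (p +ᵖ q) -ᵖ γ ∈ℕ^ → p -ᵖ γ ∈ℕ^ ⊎ q -ᵖ γ ∈ℕ^

unit : Fin d → Vec ℕ d
unit i = replicate _ 0 [ i ]≔ 1

lookup-unit : (i : Fin d) → lookup (unit i) i ≡ 1
lookup-unit i = lookup∘update i (replicate _ 0) 1

lookup-unit′ : {i k : Fin d} → k ≢ i → lookup (unit i) k ≡ 0
lookup-unit′ {k = k} k≢i =
  trans (lookup∘update′ k≢i (replicate _ 0) 1) (lookup-replicate k 0)

splits⇒≤unit : (γ : Vec ℤ d) → Splits γ → ∀ i → 0ℤ ℤ.< lookup γ i →
  ∀ k → lookup γ k ℤ.≤ + lookup (unit i) k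
splits⇒≤unit γ splits i 0<γᵢ with splits (unit i) q (≤⇒legal (unit i +ᵖ q) γ γ≤unit+q)
  where
  -- Absolute values bound all entries by naturals, so after lowering coordinate i by one, adding
  -- the unit vector at i restores legality.
  q = updateAt (map ∣_∣ γ) i pred
  γ≤unit+q : ∀ k → lookup γ k ℤ.≤ + lookup (unit i +ᵖ q) k
  γ≤unit+q k rewrite lookup-zipWith ℕ._+_ k (unit i) q with k ≟ i
  ... | yes refl
    rewrite lookup-unit k | lookup∘updateAt k {pred} (map ∣_∣ γ) | lookup-map k ∣_∣ γ =
    ℤ.≤-trans (i≤+∣i∣ (lookup γ k)) (+≤+ (ℕ.m≤n+m∸n ∣ lookup γ k ∣ 1))
  ... | no k≢i
    rewrite lookup-unit′ k≢i | lookup∘updateAt′ k i {pred} k≢i (map ∣_∣ γ) | lookup-map k ∣_∣ γ =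
    i≤+∣i∣ (lookup γ k)
... | inj₁ unit-legal = legal⇒≤ (unit i) γ unit-legal
... | inj₂ q-legal    = contradiction
  (subst (λ n → lookup γ i ℤ.≤ + n)
    (trans (lookup∘updateAt i (map ∣_∣ γ)) (cong pred (lookup-map i ∣_∣ γ)))
    (legal⇒≤ _ γ q-legal i))
  (0<i⇒i≰pred∣i∣ 0<γᵢ)

splits⇒atMostOne : {Γ : List (Vec ℤ d)} → SplitsLegalMoves Γ → AtMostOnePositiveEntryAtMost1 Γ
splits⇒atMostOne splits γ γ∈Γ = unique , ≤1
  where
  γ≤unit : ∀ i → 0ℤ ℤ.< lookup γ i → ∀ k → lookup γ k ℤ.≤ + lookup (unit i) k
  γ≤unit = splits⇒≤unit γ (splits γ γ∈Γ)
  unique : ∀ i j → 0ℤ ℤ.< lookup γ i → 0ℤ ℤ.< lookup γ j → i ≡ j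
  unique i j 0<γᵢ 0<γⱼ with i ≟ j
  ... | yes i≡j = i≡j
  -- The unit vector at j vanishes at i, so the bound it gives forces γᵢ ≤ 0.
  ... | no  i≢j = contradiction
    (subst (λ n → lookup γ i ℤ.≤ + n) (lookup-unit′ i≢j) (γ≤unit j 0<γⱼ i)) (ℤ.<⇒≱ 0<γᵢ)
  ≤1 : ∀ i → 0ℤ ℤ.< lookup γ i → lookup γ i ℤ.≤ 1ℤ
  ≤1 i 0<γᵢ = subst (λ n → lookup γ i ℤ.≤ + n) (lookup-unit i) (γ≤unit i 0<γᵢ i)

-- Only the single positive coordinate i can obstruct the move, and one heap of size i suffices
-- there. If p + q has such a heap, then so does p or q.
atMostOne⇒splits : {Γ : List (Vec ℤ d)} → AtMostOnePositiveEntryAtMost1 Γ → SplitsLegalMoves Γ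
atMostOne⇒splits atMostOne γ γ∈Γ p q legal with any? (λ i → 0ℤ ℤ.<? lookup γ i)
-- With no positive entry the move is legal everywhere; choosing p is arbitrary.
... | no ¬pos = inj₁ (≤⇒legal p γ λ k →
  ℤ.≤-trans (ℤ.≮⇒≥ (λ 0<γₖ → ¬pos (k , 0<γₖ))) (+≤+ z≤n))
... | yes (i , 0<γᵢ) = split (lookup p i) refl
  where
  legal-at : ∀ r → lookup γ i ℤ.≤ + lookup r i → r -ᵖ γ ∈ℕ^
  legal-at r γᵢ≤rᵢ = ≤⇒legal r γ γ≤r
    where
    γ≤r : ∀ k → lookup γ k ℤ.≤ + lookup r k
    γ≤r k with 0ℤ ℤ.<? lookup γ k
    ... | no  0≮γₖ = ℤ.≤-trans (ℤ.≮⇒≥ 0≮γₖ) (+≤+ z≤n)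
    ... | yes 0<γₖ with refl ← proj₁ (atMostOne γ γ∈Γ) i k 0<γᵢ 0<γₖ = γᵢ≤rᵢ
  -- If pᵢ = 0, then p + q and q agree at i and legality passes to q; otherwise γᵢ ≤ 1 ≤ pᵢ.
  split : ∀ n → lookup p i ≡ n → p -ᵖ γ ∈ℕ^ ⊎ q -ᵖ γ ∈ℕ^
  split zero pᵢ≡0 = inj₂ (legal-at q (subst (λ n → lookup γ i ℤ.≤ + n)
    (trans (lookup-zipWith ℕ._+_ i p q) (cong (ℕ._+ lookup q i) pᵢ≡0))
    (legal⇒≤ (p +ᵖ q) γ legal i)))
  split (suc n) pᵢ≡1+n = inj₁ (legal-at p
    (ℤ.≤-trans (proj₂ (atMostOne γ γ∈Γ) i 0<γᵢ)
      (subst (λ m → 1ℤ ℤ.≤ + m) (sym pᵢ≡1+n) (+≤+ (s≤s z≤n)))))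

-- Positive parts.

lookup-₊-pos : ∀ (γ : Vec ℤ d) i → 0ℤ ℤ.< lookup γ i → lookup (γ ₊) i ≡ lookup γ i
lookup-₊-pos γ i 0<γᵢ =
  trans (lookup-map i (ℤ._⊔ 0ℤ) γ) (ℤ.i≥j⇒i⊔j≡i (ℤ.<⇒≤ 0<γᵢ))

lookup-₊-nonpos : ∀ (γ : Vec ℤ d) i → lookup γ i ℤ.≤ 0ℤ → lookup (γ ₊) i ≡ 0ℤ
lookup-₊-nonpos γ i γᵢ≤0 = trans (lookup-map i (ℤ._⊔ 0ℤ) γ) (ℤ.i≤j⇒i⊔j≡j γᵢ≤0)

-- The value 1 cannot arise from clamping, which yields 0.
lookup-₊≡1⇒pos : ∀ (γ : Vec ℤ d) i → lookup (γ ₊) i ≡ 1ℤ → 0ℤ ℤ.< lookup γ i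
lookup-₊≡1⇒pos γ i γ₊ᵢ≡1 with 0ℤ ℤ.<? lookup γ i
... | yes 0<γᵢ = 0<γᵢ
... | no  0≮γᵢ with () ← trans (sym γ₊ᵢ≡1) (lookup-₊-nonpos γ i (ℤ.≮⇒≥ 0≮γᵢ))

atMostOne⇔positivePart : {Γ : List (Vec ℤ d)} →
  AtMostOnePositiveEntryAtMost1 Γ ⇔ PositivePart01AtMostOne1 Γ
atMostOne⇔positivePart {Γ = Γ} = mk⇔ to from
  where
  to : AtMostOnePositiveEntryAtMost1 Γ → PositivePart01AtMostOne1 Γ
  to atMostOne γ γ∈Γ =
      01-valued
    , λ i j γ₊ᵢ≡1 γ₊ⱼ≡1 → unique i j (lookup-₊≡1⇒pos γ i γ₊ᵢ≡1) (lookup-₊≡1⇒pos γ j γ₊ⱼ≡1)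
    where
    unique = proj₁ (atMostOne γ γ∈Γ)
    ≤1     = proj₂ (atMostOne γ γ∈Γ)
    01-valued : ∀ i → lookup (γ ₊) i ≡ 0ℤ ⊎ lookup (γ ₊) i ≡ 1ℤ
    01-valued i with 0ℤ ℤ.<? lookup γ i
    ... | yes 0<γᵢ = inj₂ (trans (lookup-₊-pos γ i 0<γᵢ) (0<i≤1⇒i≡1 0<γᵢ (≤1 i 0<γᵢ)))
    ... | no  0≮γᵢ = inj₁ (lookup-₊-nonpos γ i (ℤ.≮⇒≥ 0≮γᵢ))

  from : PositivePart01AtMostOne1 Γ → AtMostOnePositiveEntryAtMost1 Γ
  from positivePart γ γ∈Γ =
      (λ i j 0<γᵢ 0<γⱼ → unique i j (γ₊≡1 i 0<γᵢ) (γ₊≡1 j 0<γⱼ))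
    , λ i 0<γᵢ → ℤ.≤-reflexive (trans (sym (lookup-₊-pos γ i 0<γᵢ)) (γ₊≡1 i 0<γᵢ))
    where
    unique = proj₂ (positivePart γ γ∈Γ)
    γ₊≡1 : ∀ i → 0ℤ ℤ.< lookup γ i → lookup (γ ₊) i ≡ 1ℤ
    γ₊≡1 i 0<γᵢ with proj₁ (positivePart γ γ∈Γ) i
    ... | inj₂ γ₊ᵢ≡1 = γ₊ᵢ≡1
    ... | inj₁ γ₊ᵢ≡0 =
      contradiction 0<γᵢ (ℤ.<-irrefl (trans (sym γ₊ᵢ≡0) (lookup-₊-pos γ i 0<γᵢ)))

-- Decrease of exactly one heap size.

atMostOne⇔exactlyOne : {Γ : List (Vec ℤ d)} → IsRuleSet Γ →
  AtMostOnePositiveEntryAtMost1 Γ ⇔ DecreasesExactlyOneSizeBy1 Γ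
atMostOne⇔exactlyOne {Γ = Γ} ruleSet = mk⇔ to from
  where
  to : AtMostOnePositiveEntryAtMost1 Γ → DecreasesExactlyOneSizeBy1 Γ
  to atMostOne γ γ∈Γ =
    let unique , ≤1 = atMostOne γ γ∈Γ
        i , 0<γᵢ    = positive-entry ruleSet γ γ∈Γ
    in (i , 0<γᵢ , λ {j} → unique i j 0<γᵢ) , 0<i≤1⇒i≡1 0<γᵢ (≤1 i 0<γᵢ)

  from : DecreasesExactlyOneSizeBy1 Γ → AtMostOnePositiveEntryAtMost1 Γ
  from exactlyOne γ γ∈Γ with exactlyOne γ γ∈Γ
  ... | (i , _ , unique) , γᵢ≡1 =
      -- Uniqueness compares each positive index with the chosen i, hence any two with each other;
      -- it also carries γᵢ = 1 to every positive entry.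
      (λ j k 0<γⱼ 0<γₖ → trans (sym (unique 0<γⱼ)) (unique 0<γₖ))
    , λ j 0<γⱼ → subst (λ k → lookup γ k ℤ.≤ 1ℤ) (unique 0<γⱼ) (ℤ.≤-reflexive γᵢ≡1)

proposition1 : (d : ℕ) → d ≥ 1 → (Γ : List (Vec ℤ d)) → IsRuleSet Γ →
    (SplitsLegalMoves Γ ⇔ AtMostOnePositiveEntryAtMost1 Γ)
    × (AtMostOnePositiveEntryAtMost1 Γ ⇔ PositivePart01AtMostOne1 Γ)
    × (PositivePart01AtMostOne1 Γ ⇔ DecreasesExactlyOneSizeBy1 Γ)
proposition1 d d≥1 Γ ruleSet =
    mk⇔ splits⇒atMostOne atMostOne⇒splits
  , atMostOne⇔positivePart
  -- The last equivalence passes through the bound on positive entries.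
  , atMostOne⇔exactlyOne ruleSet ⇔-∘ ⇔-sym atMostOne⇔positivePart
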